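{- For $f(x)=x+b+\frac{c}{x}$ with nonzero integers $b,c$, the Diophantine equation $z^2=f(x)^2+f(y)^2$ or the Diophantine equation $z^2=f(x)^2-f(y)^2$ has infinitely many nontrivial rational parametric solutions.
   Context: A rational parametric solution of one of the equations $z^2=f(x)^2\pm f(y)^2$ is a triple $(x,y,z)$ of rational functions in $\mathbb{Q}(T)$, where $T$ is an indeterminate (the parameter), not all constant, with $x\neq 0$ and $y\neq 0$ (so that $f(x),f(y)$ are defined), satisfying the equation identically in $\mathbb{Q}(T)$. A solution $(x,y,z)$ of $z^2=f(x)^2+f(y)^2$ is called nontrivial if $f(x)f(y)\neq 0$; a solution $(x,y,z)$ of $z^2=f(x)^2-f(y)^2$ is called nontrivial if $f(x)^2\neq f(y)^2$. -}

module Defs where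

open import Algebra.Bundles using (CommutativeRing)
open import Data.Empty using (⊥-elim)
open import Data.Integer.Base using (ℤ)
open import Data.List.Base using (List; []; _∷_; map)
open import Data.Maybe.Base using (nothing)
open import Data.Nat.Base using (ℕ; zero; suc)
open import Data.Product.Base using (_×_; _,_; proj₁; ∃)
open import Data.Product.Relation.Binary.Pointwise.NonDependent using (×-setoid)
open import Data.Rational.Base as ℚ using (ℚ; 0ℚ; 1ℚ; ≢-nonZero)
import Data.Rational.Properties as ℚ
open import Data.Sum.Base using (_⊎_; inj₁; inj₂; [_,_]′)
open import Function.Bundles using (Injection)
open import Level using (0ℓ)
open import Relation.Binary.Bundles using (Setoid)
import Relation.Binary.Construct.On as On
open import Relation.Binary.PropositionalEquality as ≡ using (_≡_)
import Relation.Binary.Reasoning.Setoid as ≈-Reasoning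
open import Relation.Nullary.Decidable using (yes; no)
open import Relation.Nullary.Negation using (¬_)
open import Tactic.RingSolver using (solve-∀)
open import Tactic.RingSolver.Core.AlmostCommutativeRing
  using (AlmostCommutativeRing; fromCommutativeRing)

module Poly where

  -- Coefficients in increasing order of degree.  Trailing zeros are
  -- allowed, so polynomials are compared with _≈_ and not with _≡_.
  ℚ[T] : Set
  ℚ[T] = List ℚ

  coeff : ℚ[T] → ℕ → ℚ
  coeff []      n       = 0ℚ
  coeff (a ∷ p) zero    = a
  coeff (a ∷ p) (suc n) = coeff p n

  infix  4 _≈_ _≉_
  infixl 6 _+_
  infixl 7 _*_
  infix  8 -_
  infixr 8 _·_

  -- A record rather than a bare function type, so that p and q can be
  -- inferred from a proof.
  record _≈_ (p q : ℚ[T]) : Set where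
    constructor mk≈
    field at : ∀ n → coeff p n ≡ coeff q n
  open _≈_ public

  _≉_ : ℚ[T] → ℚ[T] → Set
  p ≉ q = ¬ (p ≈ q)

  0# 1# : ℚ[T]
  0# = []
  1# = 1ℚ ∷ []

  _+_ : ℚ[T] → ℚ[T] → ℚ[T]
  []      + q       = q
  (a ∷ p) + []      = a ∷ p
  (a ∷ p) + (b ∷ q) = (a ℚ.+ b) ∷ (p + q)

  _·_ : ℚ → ℚ[T] → ℚ[T]
  a · p = map (a ℚ.*_) p

  -_ : ℚ[T] → ℚ[T]
  -_ = map (λ a → ℚ.- a)

  _*_ : ℚ[T] → ℚ[T] → ℚ[T]
  []      * q = []
  (a ∷ p) * q = a · q + (0ℚ ∷ p * q)

  ≈-refl : ∀ {p} → p ≈ p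
  ≈-refl = mk≈ λ _ → ≡.refl

  ≈-sym : ∀ {p q} → p ≈ q → q ≈ p
  ≈-sym p≈q = mk≈ λ n → ≡.sym (at p≈q n)

  ≈-trans : ∀ {p q r} → p ≈ q → q ≈ r → p ≈ r
  ≈-trans p≈q q≈r = mk≈ λ n → ≡.trans (at p≈q n) (at q≈r n)

  setoid : Setoid 0ℓ 0ℓ
  setoid = record
    { Carrier       = ℚ[T]
    ; _≈_           = _≈_
    ; isEquivalence = record { refl = ≈-refl ; sym = ≈-sym ; trans = ≈-trans }
    }

  ∷-cong : ∀ {a b p q} → a ≡ b → p ≈ q → a ∷ p ≈ b ∷ q
  ∷-cong {a} {b} {p} {q} a≡b p≈q = mk≈ go
    where
    go : ∀ n → coeff (a ∷ p) n ≡ coeff (b ∷ q) n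
    go zero    = a≡b
    go (suc n) = at p≈q n

  ∷-tail : ∀ {a b p q} → a ∷ p ≈ b ∷ q → p ≈ q
  ∷-tail e = mk≈ λ n → at e (suc n)

  0∷-zero : ∀ {a p} → a ≡ 0ℚ → p ≈ 0# → a ∷ p ≈ 0#
  0∷-zero {a} {p} a≡0 p≈0 = mk≈ go
    where
    go : ∀ n → coeff (a ∷ p) n ≡ 0ℚ
    go zero    = a≡0
    go (suc n) = at p≈0 n

  coeff-+ : ∀ p q n → coeff (p + q) n ≡ coeff p n ℚ.+ coeff q n
  coeff-+ []      q       n       = ≡.sym (ℚ.+-identityˡ _)
  coeff-+ (a ∷ p) []      n       = ≡.sym (ℚ.+-identityʳ _)
  coeff-+ (a ∷ p) (b ∷ q) zero    = ≡.refl
  coeff-+ (a ∷ p) (b ∷ q) (suc n) = coeff-+ p q n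

  coeff-· : ∀ a p n → coeff (a · p) n ≡ a ℚ.* coeff p n
  coeff-· a []      n       = ≡.sym (ℚ.*-zeroʳ a)
  coeff-· a (b ∷ p) zero    = ≡.refl
  coeff-· a (b ∷ p) (suc n) = coeff-· a p n

  coeff-neg : ∀ p n → coeff (- p) n ≡ ℚ.- coeff p n
  coeff-neg []      n       = ≡.refl
  coeff-neg (a ∷ p) zero    = ≡.refl
  coeff-neg (a ∷ p) (suc n) = coeff-neg p n

  +-cong : ∀ {p p′ q q′} → p ≈ p′ → q ≈ q′ → p + q ≈ p′ + q′
  +-cong {p} {p′} {q} {q′} e e′ = mk≈ λ n → begin
    coeff (p + q) n              ≡⟨ coeff-+ p q n ⟩
    coeff p n ℚ.+ coeff q n      ≡⟨ ≡.cong₂ ℚ._+_ (at e n) (at e′ n) ⟩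
    coeff p′ n ℚ.+ coeff q′ n    ≡⟨ coeff-+ p′ q′ n ⟨
    coeff (p′ + q′) n            ∎
    where open ≡.≡-Reasoning

  +-assoc : ∀ p q r → (p + q) + r ≈ p + (q + r)
  +-assoc p q r = mk≈ λ n → begin
    coeff ((p + q) + r) n                        ≡⟨ coeff-+ (p + q) r n ⟩
    coeff (p + q) n ℚ.+ coeff r n                ≡⟨ ≡.cong (ℚ._+ coeff r n) (coeff-+ p q n) ⟩
    (coeff p n ℚ.+ coeff q n) ℚ.+ coeff r n      ≡⟨ ℚ.+-assoc (coeff p n) _ _ ⟩
    coeff p n ℚ.+ (coeff q n ℚ.+ coeff r n)      ≡⟨ ≡.cong (coeff p n ℚ.+_) (coeff-+ q r n) ⟨
    coeff p n ℚ.+ coeff (q + r) n                ≡⟨ coeff-+ p (q + r) n ⟨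
    coeff (p + (q + r)) n                        ∎
    where open ≡.≡-Reasoning

  +-comm : ∀ p q → p + q ≈ q + p
  +-comm p q = mk≈ λ n → ≡.trans (coeff-+ p q n)
    (≡.trans (ℚ.+-comm (coeff p n) _) (≡.sym (coeff-+ q p n)))

  +-identityʳ : ∀ p → p + 0# ≈ p
  +-identityʳ p = +-comm p 0#

  -‿cong : ∀ {p q} → p ≈ q → - p ≈ - q
  -‿cong {p} {q} e = mk≈ λ n → ≡.trans (coeff-neg p n)
    (≡.trans (≡.cong (λ a → ℚ.- a) (at e n)) (≡.sym (coeff-neg q n)))

  -‿inverseˡ : ∀ p → (- p) + p ≈ 0#
  -‿inverseˡ p = mk≈ λ n → ≡.trans (coeff-+ (- p) p n)
    (≡.trans (≡.cong (ℚ._+ coeff p n) (coeff-neg p n)) (ℚ.+-inverseˡ (coeff p n)))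

  -‿inverseʳ : ∀ p → p + (- p) ≈ 0#
  -‿inverseʳ p = ≈-trans (+-comm p (- p)) (-‿inverseˡ p)

  +-interchange : ∀ p q r s → (p + q) + (r + s) ≈ (p + r) + (q + s)
  +-interchange p q r s = begin
    (p + q) + (r + s)  ≈⟨ +-assoc p q (r + s) ⟩
    p + (q + (r + s))  ≈⟨ +-cong {p} ≈-refl (+-assoc q r s) ⟨
    p + ((q + r) + s)  ≈⟨ +-cong {p} ≈-refl (+-cong {q = s} (+-comm q r) ≈-refl) ⟩
    p + ((r + q) + s)  ≈⟨ +-cong {p} ≈-refl (+-assoc r q s) ⟩
    p + (r + (q + s))  ≈⟨ +-assoc p r (q + s) ⟨
    (p + r) + (q + s)  ∎
    where open ≈-Reasoning setoid

  ·-cong : ∀ {a b p q} → a ≡ b → p ≈ q → a · p ≈ b · q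
  ·-cong {a} {b} {p} {q} e e′ = mk≈ λ n → ≡.trans (coeff-· a p n)
    (≡.trans (≡.cong₂ ℚ._*_ e (at e′ n)) (≡.sym (coeff-· b q n)))

  ·-zeroˡ : ∀ p → 0ℚ · p ≈ 0#
  ·-zeroˡ p = mk≈ λ n → ≡.trans (coeff-· 0ℚ p n) (ℚ.*-zeroˡ (coeff p n))

  ·-identityˡ : ∀ p → 1ℚ · p ≈ p
  ·-identityˡ p = mk≈ λ n → ≡.trans (coeff-· 1ℚ p n) (ℚ.*-identityˡ (coeff p n))

  ·-distribˡ : ∀ a p q → a · (p + q) ≈ a · p + a · q
  ·-distribˡ a p q = mk≈ λ n → begin
    coeff (a · (p + q)) n                            ≡⟨ coeff-· a (p + q) n ⟩
    a ℚ.* coeff (p + q) n                            ≡⟨ ≡.cong (a ℚ.*_) (coeff-+ p q n) ⟩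
    a ℚ.* (coeff p n ℚ.+ coeff q n)                  ≡⟨ ℚ.*-distribˡ-+ a (coeff p n) _ ⟩
    a ℚ.* coeff p n ℚ.+ a ℚ.* coeff q n              ≡⟨ ≡.cong₂ ℚ._+_ (coeff-· a p n) (coeff-· a q n) ⟨
    coeff (a · p) n ℚ.+ coeff (a · q) n              ≡⟨ coeff-+ (a · p) (a · q) n ⟨
    coeff (a · p + a · q) n                          ∎
    where open ≡.≡-Reasoning

  ·-distribʳ : ∀ a b p → (a ℚ.+ b) · p ≈ a · p + b · p
  ·-distribʳ a b p = mk≈ λ n → begin
    coeff ((a ℚ.+ b) · p) n                          ≡⟨ coeff-· (a ℚ.+ b) p n ⟩
    (a ℚ.+ b) ℚ.* coeff p n                          ≡⟨ ℚ.*-distribʳ-+ (coeff p n) a b ⟩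
    a ℚ.* coeff p n ℚ.+ b ℚ.* coeff p n              ≡⟨ ≡.cong₂ ℚ._+_ (coeff-· a p n) (coeff-· b p n) ⟨
    coeff (a · p) n ℚ.+ coeff (b · p) n              ≡⟨ coeff-+ (a · p) (b · p) n ⟨
    coeff (a · p + b · p) n                          ∎
    where open ≡.≡-Reasoning

  ·-assoc : ∀ a b p → (a ℚ.* b) · p ≈ a · (b · p)
  ·-assoc a b p = mk≈ λ n → begin
    coeff ((a ℚ.* b) · p) n    ≡⟨ coeff-· (a ℚ.* b) p n ⟩
    (a ℚ.* b) ℚ.* coeff p n    ≡⟨ ℚ.*-assoc a b (coeff p n) ⟩
    a ℚ.* (b ℚ.* coeff p n)    ≡⟨ ≡.cong (a ℚ.*_) (coeff-· b p n) ⟨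
    a ℚ.* coeff (b · p) n      ≡⟨ coeff-· a (b · p) n ⟨
    coeff (a · (b · p)) n      ∎
    where open ≡.≡-Reasoning

  *-congˡ : ∀ p {q q′} → q ≈ q′ → p * q ≈ p * q′
  *-congˡ []      e = ≈-refl
  *-congˡ (a ∷ p) e = +-cong (·-cong {a} ≡.refl e) (∷-cong ≡.refl (*-congˡ p e))

  *-zeroʳ : ∀ p → p * 0# ≈ 0#
  *-zeroʳ []      = ≈-refl
  *-zeroʳ (a ∷ p) = 0∷-zero ≡.refl (*-zeroʳ p)

  *-∷ʳ : ∀ p b q → p * (b ∷ q) ≈ b · p + (0ℚ ∷ p * q)
  *-∷ʳ []      b q = ≈-sym (0∷-zero ≡.refl ≈-refl)
  *-∷ʳ (a ∷ p) b q = ∷-cong (≡.cong (ℚ._+ 0ℚ) (ℚ.*-comm a b)) (begin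
    a · q + p * (b ∷ q)              ≈⟨ +-cong {a · q} ≈-refl (*-∷ʳ p b q) ⟩
    a · q + (b · p + (0ℚ ∷ p * q))   ≈⟨ +-assoc (a · q) (b · p) _ ⟨
    (a · q + b · p) + (0ℚ ∷ p * q)   ≈⟨ +-cong {q = 0ℚ ∷ p * q} (+-comm (a · q) (b · p)) ≈-refl ⟩
    (b · p + a · q) + (0ℚ ∷ p * q)   ≈⟨ +-assoc (b · p) (a · q) _ ⟩
    b · p + (a · q + (0ℚ ∷ p * q))   ∎)
    where open ≈-Reasoning setoid

  *-comm : ∀ p q → p * q ≈ q * p
  *-comm []      q = ≈-sym (*-zeroʳ q)
  *-comm (a ∷ p) q = begin
    a · q + (0ℚ ∷ p * q)  ≈⟨ +-cong {a · q} ≈-refl (∷-cong ≡.refl (*-comm p q)) ⟩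
    a · q + (0ℚ ∷ q * p)  ≈⟨ *-∷ʳ q a p ⟨
    q * (a ∷ p)           ∎
    where open ≈-Reasoning setoid

  *-cong : ∀ {p p′ q q′} → p ≈ p′ → q ≈ q′ → p * q ≈ p′ * q′
  *-cong {p} {p′} {q} {q′} e e′ = begin
    p * q    ≈⟨ *-congˡ p e′ ⟩
    p * q′   ≈⟨ *-comm p q′ ⟩
    q′ * p   ≈⟨ *-congˡ q′ e ⟩
    q′ * p′  ≈⟨ *-comm q′ p′ ⟩
    p′ * q′  ∎
    where open ≈-Reasoning setoid

  *-distribʳ : ∀ r p q → (p + q) * r ≈ p * r + q * r
  *-distribʳ r []      q       = ≈-refl
  *-distribʳ r (a ∷ p) []      = ≈-sym (+-identityʳ _)
  *-distribʳ r (a ∷ p) (b ∷ q) = begin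
    (a ℚ.+ b) · r + (0ℚ ∷ (p + q) * r)
      ≈⟨ +-cong (·-distribʳ a b r) (∷-cong ≡.refl (*-distribʳ r p q)) ⟩
    (a · r + b · r) + ((0ℚ ∷ p * r) + (0ℚ ∷ q * r))
      ≈⟨ +-interchange (a · r) (b · r) _ _ ⟩
    (a · r + (0ℚ ∷ p * r)) + (b · r + (0ℚ ∷ q * r)) ∎
    where open ≈-Reasoning setoid

  *-distribˡ : ∀ r p q → r * (p + q) ≈ r * p + r * q
  *-distribˡ r p q = begin
    r * (p + q)    ≈⟨ *-comm r (p + q) ⟩
    (p + q) * r    ≈⟨ *-distribʳ r p q ⟩
    p * r + q * r  ≈⟨ +-cong (*-comm p r) (*-comm q r) ⟩
    r * p + r * q  ∎
    where open ≈-Reasoning setoid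

  ·-*-assoc : ∀ a p q → (a · p) * q ≈ a · (p * q)
  ·-*-assoc a []      q = ≈-refl
  ·-*-assoc a (b ∷ p) q = begin
    (a ℚ.* b) · q + (0ℚ ∷ (a · p) * q)
      ≈⟨ +-cong (·-assoc a b q) (∷-cong (≡.sym (ℚ.*-zeroʳ a)) (·-*-assoc a p q)) ⟩
    a · (b · q) + a · (0ℚ ∷ p * q)
      ≈⟨ ·-distribˡ a (b · q) (0ℚ ∷ p * q) ⟨
    a · (b · q + (0ℚ ∷ p * q)) ∎
    where open ≈-Reasoning setoid

  0∷-* : ∀ p q → (0ℚ ∷ p) * q ≈ 0ℚ ∷ p * q
  0∷-* p q = +-cong (·-zeroˡ q) ≈-refl

  *-assoc : ∀ p q r → (p * q) * r ≈ p * (q * r)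
  *-assoc []      q r = ≈-refl
  *-assoc (a ∷ p) q r = begin
    (a · q + (0ℚ ∷ p * q)) * r        ≈⟨ *-distribʳ r (a · q) (0ℚ ∷ p * q) ⟩
    (a · q) * r + (0ℚ ∷ p * q) * r    ≈⟨ +-cong (·-*-assoc a q r) (0∷-* (p * q) r) ⟩
    a · (q * r) + (0ℚ ∷ (p * q) * r)  ≈⟨ +-cong {a · (q * r)} ≈-refl (∷-cong ≡.refl (*-assoc p q r)) ⟩
    a · (q * r) + (0ℚ ∷ p * (q * r))  ∎
    where open ≈-Reasoning setoid

  *-identityˡ : ∀ p → 1# * p ≈ p
  *-identityˡ p = begin
    1ℚ · p + (0ℚ ∷ [])  ≈⟨ +-cong (·-identityˡ p) (0∷-zero ≡.refl ≈-refl) ⟩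
    p + 0#              ≈⟨ +-identityʳ p ⟩
    p                   ∎
    where open ≈-Reasoning setoid

  *-identityʳ : ∀ p → p * 1# ≈ p
  *-identityʳ p = ≈-trans (*-comm p 1#) (*-identityˡ p)

  commutativeRing : CommutativeRing 0ℓ 0ℓ
  commutativeRing = record
    { Carrier = ℚ[T] ; _≈_ = _≈_
    ; _+_ = _+_ ; _*_ = _*_ ; -_ = -_ ; 0# = 0# ; 1# = 1#
    ; isCommutativeRing = record
      { isRing = record
        { +-isAbelianGroup = record
          { isGroup = record
            { isMonoid = record
              { isSemigroup = record
                { isMagma = record
                  { isEquivalence = Setoid.isEquivalence setoid
                  ; ∙-cong        = +-cong
                  }
                ; assoc = +-assoc
                }
              ; identity = (λ _ → ≈-refl) , +-identityʳ
              }
            ; inverse = -‿inverseˡ , -‿inverseʳ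
            ; ⁻¹-cong = -‿cong
            }
          ; comm = +-comm
          }
        ; *-cong     = *-cong
        ; *-assoc    = *-assoc
        ; *-identity = *-identityˡ , *-identityʳ
        ; distrib    = *-distribˡ , *-distribʳ
        }
      ; *-comm = *-comm
      }
    }

  almostRing : AlmostCommutativeRing 0ℓ 0ℓ
  almostRing = fromCommutativeRing commutativeRing (λ _ → nothing)

  ℚ-cancelˡ : ∀ {a b} → ¬ (a ≡ 0ℚ) → a ℚ.* b ≡ 0ℚ → b ≡ 0ℚ
  ℚ-cancelˡ {a} {b} a≢0 ab≡0 = begin
    b                        ≡⟨ ℚ.*-identityˡ b ⟨
    1ℚ ℚ.* b                 ≡⟨ ≡.cong (ℚ._* b) (ℚ.*-inverseˡ a) ⟨
    (ℚ.1/ a ℚ.* a) ℚ.* b     ≡⟨ ℚ.*-assoc (ℚ.1/ a) a b ⟩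
    ℚ.1/ a ℚ.* (a ℚ.* b)     ≡⟨ ≡.cong (ℚ.1/ a ℚ.*_) ab≡0 ⟩
    ℚ.1/ a ℚ.* 0ℚ            ≡⟨ ℚ.*-zeroʳ (ℚ.1/ a) ⟩
    0ℚ                       ∎
    where
    open ≡.≡-Reasoning
    instance _ = ≢-nonZero a≢0

  *-cancel-unitTerm : ∀ {a} p q → ¬ (a ≡ 0ℚ) → (a ∷ p) * q ≈ 0# → q ≈ 0#
  *-cancel-unitTerm         p []      a≢0 e = ≈-refl
  *-cancel-unitTerm {a} p (b ∷ q) a≢0 e =
    0∷-zero b≡0 (*-cancel-unitTerm p q a≢0 tail≈0)
    where
    open ≈-Reasoning setoid
    b≡0 : b ≡ 0ℚ
    b≡0 = ℚ-cancelˡ a≢0 (≡.trans (≡.sym (ℚ.+-identityʳ (a ℚ.* b))) (at e zero))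
    shifted : 0ℚ ∷ (a ∷ p) * q ≈ 0ℚ ∷ 0#
    shifted = begin
      0ℚ ∷ (a ∷ p) * q                     ≈⟨ +-cong (·-zeroˡ (a ∷ p)) ≈-refl ⟨
      0ℚ · (a ∷ p) + (0ℚ ∷ (a ∷ p) * q)    ≈⟨ *-∷ʳ (a ∷ p) 0ℚ q ⟨
      (a ∷ p) * (0ℚ ∷ q)                   ≈⟨ *-congˡ (a ∷ p) (∷-cong (≡.sym b≡0) ≈-refl) ⟩
      (a ∷ p) * (b ∷ q)                    ≈⟨ e ⟩
      0#                                   ≈⟨ 0∷-zero ≡.refl ≈-refl ⟨
      0ℚ ∷ 0#                              ∎
    tail≈0 : (a ∷ p) * q ≈ 0#
    tail≈0 = ∷-tail shifted

  integral : ∀ p q → p * q ≈ 0# → p ≈ 0# ⊎ q ≈ 0#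
  integral []      q e = inj₁ ≈-refl
  integral (a ∷ p) q e with a ℚ.≟ 0ℚ
  ... | no  a≢0    = inj₂ (*-cancel-unitTerm p q a≢0 e)
  ... | yes ≡.refl with integral p q (∷-tail (≈-trans (≈-sym (0∷-* p q))
                          (≈-trans e (≈-sym (0∷-zero ≡.refl ≈-refl)))))
  ...   | inj₁ p≈0 = inj₁ (0∷-zero ≡.refl p≈0)
  ...   | inj₂ q≈0 = inj₂ q≈0

  *-≉0 : ∀ {p q} → p ≉ 0# → q ≉ 0# → p * q ≉ 0#
  *-≉0 {p} {q} p≉0 q≉0 e with integral p q e
  ... | inj₁ p≈0 = p≉0 p≈0
  ... | inj₂ q≈0 = q≉0 q≈0

  1≉0 : 1# ≉ 0#
  1≉0 e with at e zero
  ... | ()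

  *-cancelˡ : ∀ {r p q} → r ≉ 0# → r * p ≈ r * q → p ≈ q
  *-cancelˡ {r} {p} {q} r≉0 e = [ (λ r≈0 → ⊥-elim (r≉0 r≈0)) , p≈q ]′
    (integral r (p + (- q)) r[p-q]≈0)
    where
    open ≈-Reasoning setoid
    expand : ∀ r p q → r * (p + (- q)) ≈ r * p + (- (r * q))
    expand = solve-∀ almostRing
    r[p-q]≈0 : r * (p + (- q)) ≈ 0#
    r[p-q]≈0 = begin
      r * (p + (- q))        ≈⟨ expand r p q ⟩
      r * p + (- (r * q))    ≈⟨ +-cong e ≈-refl ⟩
      r * q + (- (r * q))    ≈⟨ -‿inverseʳ (r * q) ⟩
      0#                     ∎
    p≈q : p + (- q) ≈ 0# → p ≈ q
    p≈q p-q≈0 = begin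
      p                  ≈⟨ +-identityʳ p ⟨
      p + 0#             ≈⟨ +-cong {p} ≈-refl (-‿inverseˡ q) ⟨
      p + ((- q) + q)    ≈⟨ +-assoc p (- q) q ⟨
      (p + (- q)) + q    ≈⟨ +-cong p-q≈0 ≈-refl ⟩
      q                  ∎

module Identities where
  open Poly

  comm-last : ∀ p q r → (p * q) * r ≈ (p * r) * q
  comm-last = solve-∀ almostRing

  rotate : ∀ p q r → p * (q * r) ≈ (q * p) * r
  rotate = solve-∀ almostRing

  interchange : ∀ p q r s → (p * q) * (r * s) ≈ (p * r) * (q * s)
  interchange = solve-∀ almostRing

  assoc : ∀ p q r s t u → ((p * q) * r) * (s * (t * u)) ≈ (p * (q * r)) * ((s * t) * u)
  assoc = solve-∀ almostRing

  comm : ∀ p q r s → (p * q) * (r * s) ≈ (q * p) * (s * r)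
  comm = solve-∀ almostRing

  +-expand : ∀ p q u v q′ v′ →
    (p * v + u * q) * (q′ * v′) ≈ (p * q′) * (v * v′) + (u * v′) * (q * q′)
  +-expand = solve-∀ almostRing

  +-collect : ∀ p′ q′ u′ v′ q v →
    (p′ * q) * (v * v′) + (u′ * v) * (q * q′) ≈ (p′ * v′ + u′ * q′) * (q * v)
  +-collect = solve-∀ almostRing

  +-assoc′ : ∀ p q u v x y →
    ((p * v + u * q) * y + x * (q * v)) * (q * (v * y)) ≈
    (p * (v * y) + (u * y + x * v) * q) * ((q * v) * y)
  +-assoc′ = solve-∀ almostRing

  +-comm′ : ∀ p q u v → (p * v + u * q) * (v * q) ≈ (u * q + p * v) * (q * v)
  +-comm′ = solve-∀ almostRing

  neg-*ˡ : ∀ p q → (- p) * q ≈ - (p * q)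
  neg-*ˡ = solve-∀ almostRing

  distrib : ∀ p q u v x y →
    (p * (u * y + x * v)) * ((q * v) * (q * y)) ≈
    ((p * u) * (q * y) + (p * x) * (q * v)) * (q * (v * y))
  distrib = solve-∀ almostRing

open Poly using (ℚ[T])

infix  4 _≈_ _≉_
infixl 6 _+_ _-_
infixl 7 _*_
infix  8 -_
infixl 9 _²

-- ℚ(T) as the fraction field of ℚ[T].  Fractions need not be in lowest
-- terms; _≈_ compares them by cross-multiplication.
record ℚ⟨T⟩ : Set where
  constructor frac
  field
    num    : ℚ[T]
    den    : ℚ[T]
    den≉0  : den Poly.≉ Poly.0#

open ℚ⟨T⟩ public

record _≈_ (r s : ℚ⟨T⟩) : Set where
  constructor mk≈
  field cross : num r Poly.* den s Poly.≈ num s Poly.* den r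

open _≈_ public

_≉_ : ℚ⟨T⟩ → ℚ⟨T⟩ → Set
r ≉ s = ¬ (r ≈ s)

fromPoly : ℚ[T] → ℚ⟨T⟩
fromPoly p = frac p Poly.1# Poly.1≉0

fromℚ : ℚ → ℚ⟨T⟩
fromℚ a = fromPoly (a ∷ [])

fromℤ : ℤ → ℚ⟨T⟩
fromℤ n = fromℚ (n ℚ./ 1)

0# 1# : ℚ⟨T⟩
0# = fromPoly Poly.0#
1# = fromPoly Poly.1#

_+_ : ℚ⟨T⟩ → ℚ⟨T⟩ → ℚ⟨T⟩
frac p q q≉0 + frac p′ q′ q′≉0 =
  frac (p Poly.* q′ Poly.+ p′ Poly.* q) (q Poly.* q′) (Poly.*-≉0 q≉0 q′≉0)

_*_ : ℚ⟨T⟩ → ℚ⟨T⟩ → ℚ⟨T⟩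
frac p q q≉0 * frac p′ q′ q′≉0 = frac (p Poly.* p′) (q Poly.* q′) (Poly.*-≉0 q≉0 q′≉0)

-_ : ℚ⟨T⟩ → ℚ⟨T⟩
- frac p q q≉0 = frac (Poly.- p) q q≉0

_-_ : ℚ⟨T⟩ → ℚ⟨T⟩ → ℚ⟨T⟩
r - s = r + (- s)

_² : ℚ⟨T⟩ → ℚ⟨T⟩
r ² = r * r

≈-refl : ∀ {r} → r ≈ r
≈-refl = mk≈ Poly.≈-refl

≈-sym : ∀ {r s} → r ≈ s → s ≈ r
≈-sym e = mk≈ (Poly.≈-sym (cross e))

≈-trans : ∀ {r s t} → r ≈ s → s ≈ t → r ≈ t
≈-trans {frac p q _} {frac u v v≉0} {frac x y _} e e′ =
  mk≈ (Poly.*-cancelˡ {v} {p Poly.* y} {x Poly.* q} v≉0 (begin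
    v Poly.* (p Poly.* y)  ≈⟨ Identities.rotate v p y ⟩
    (p Poly.* v) Poly.* y  ≈⟨ Poly.*-cong (cross e) Poly.≈-refl ⟩
    (u Poly.* q) Poly.* y  ≈⟨ Identities.comm-last u q y ⟩
    (u Poly.* y) Poly.* q  ≈⟨ Poly.*-cong (cross e′) Poly.≈-refl ⟩
    (x Poly.* v) Poly.* q  ≈⟨ Identities.rotate v x q ⟨
    v Poly.* (x Poly.* q)  ∎))
  where open ≈-Reasoning Poly.setoid

setoid : Setoid 0ℓ 0ℓ
setoid = record
  { Carrier       = ℚ⟨T⟩
  ; _≈_           = _≈_
  ; isEquivalence = record { refl = ≈-refl ; sym = ≈-sym ; trans = ≈-trans }
  }

+-cong : ∀ {r r′ s s′} → r ≈ r′ → s ≈ s′ → r + s ≈ r′ + s′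
+-cong {frac p q _} {frac p′ q′ _} {frac u v _} {frac u′ v′ _} e e′ =
  mk≈ (Poly.≈-trans (Identities.+-expand p q u v q′ v′)
      (Poly.≈-trans (Poly.+-cong (Poly.*-cong (cross e) Poly.≈-refl)
                                 (Poly.*-cong (cross e′) Poly.≈-refl))
                    (Identities.+-collect p′ q′ u′ v′ q v)))

*-cong : ∀ {r r′ s s′} → r ≈ r′ → s ≈ s′ → r * s ≈ r′ * s′
*-cong {frac p q _} {frac p′ q′ _} {frac u v _} {frac u′ v′ _} e e′ =
  mk≈ (Poly.≈-trans (Identities.interchange p u q′ v′)
      (Poly.≈-trans (Poly.*-cong (cross e) (cross e′))
                    (Identities.interchange p′ q u′ v)))

-‿cong : ∀ {r s} → r ≈ s → - r ≈ - s
-‿cong {frac p q _} {frac u v _} e =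
  mk≈ (Poly.≈-trans (Identities.neg-*ˡ p v)
      (Poly.≈-trans (Poly.-‿cong (cross e)) (Poly.≈-sym (Identities.neg-*ˡ u q))))

+-assoc : ∀ r s t → (r + s) + t ≈ r + (s + t)
+-assoc (frac p q _) (frac u v _) (frac x y _) = mk≈ (Identities.+-assoc′ p q u v x y)

+-comm : ∀ r s → r + s ≈ s + r
+-comm (frac p q _) (frac u v _) = mk≈ (Identities.+-comm′ p q u v)

+-identityˡ : ∀ r → 0# + r ≈ r
+-identityˡ (frac p q _) = mk≈ (Poly.*-assoc p Poly.1# q)

+-identityʳ : ∀ r → r + 0# ≈ r
+-identityʳ r = ≈-trans (+-comm r 0#) (+-identityˡ r)

-‿inverseˡ : ∀ r → - r + r ≈ 0#
-‿inverseˡ (frac p q _) = mk≈ (begin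
  ((Poly.- p) Poly.* q Poly.+ p Poly.* q) Poly.* Poly.1#  ≈⟨ Poly.*-identityʳ _ ⟩
  (Poly.- p) Poly.* q Poly.+ p Poly.* q                   ≈⟨ Poly.+-cong (Identities.neg-*ˡ p q) Poly.≈-refl ⟩
  Poly.- (p Poly.* q) Poly.+ p Poly.* q                   ≈⟨ Poly.-‿inverseˡ (p Poly.* q) ⟩
  Poly.0#                                                 ∎)
  where open ≈-Reasoning Poly.setoid

-‿inverseʳ : ∀ r → r + - r ≈ 0#
-‿inverseʳ r = ≈-trans (+-comm r (- r)) (-‿inverseˡ r)

*-assoc : ∀ r s t → (r * s) * t ≈ r * (s * t)
*-assoc (frac p q _) (frac u v _) (frac x y _) = mk≈ (Identities.assoc p u x q v y)

*-comm : ∀ r s → r * s ≈ s * r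
*-comm (frac p q _) (frac u v _) = mk≈ (Identities.comm p u v q)

*-identityˡ : ∀ r → 1# * r ≈ r
*-identityˡ (frac p q _) = mk≈ (Poly.≈-trans
  (Poly.*-cong (Poly.*-identityˡ p) Poly.≈-refl)
  (Poly.≈-sym (Poly.*-congˡ p (Poly.*-identityˡ q))))

*-identityʳ : ∀ r → r * 1# ≈ r
*-identityʳ r = ≈-trans (*-comm r 1#) (*-identityˡ r)

*-distribˡ : ∀ r s t → r * (s + t) ≈ r * s + r * t
*-distribˡ (frac p q _) (frac u v _) (frac x y _) = mk≈ (Identities.distrib p q u v x y)

*-distribʳ : ∀ r s t → (s + t) * r ≈ s * r + t * r
*-distribʳ r s t = ≈-trans (*-comm (s + t) r)
  (≈-trans (*-distribˡ r s t) (+-cong (*-comm r s) (*-comm r t)))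

commutativeRing : CommutativeRing 0ℓ 0ℓ
commutativeRing = record
  { Carrier = ℚ⟨T⟩ ; _≈_ = _≈_
  ; _+_ = _+_ ; _*_ = _*_ ; -_ = -_ ; 0# = 0# ; 1# = 1#
  ; isCommutativeRing = record
    { isRing = record
      { +-isAbelianGroup = record
        { isGroup = record
          { isMonoid = record
            { isSemigroup = record
              { isMagma = record
                { isEquivalence = Setoid.isEquivalence setoid
                ; ∙-cong        = +-cong
                }
              ; assoc = +-assoc
              }
            ; identity = +-identityˡ , +-identityʳ
            }
          ; inverse = -‿inverseˡ , -‿inverseʳ
          ; ⁻¹-cong = -‿cong
          }
        ; comm = +-comm
        }
      ; *-cong     = *-cong
      ; *-assoc    = *-assoc
      ; *-identity = *-identityˡ , *-identityʳ
      ; distrib    = *-distribˡ , *-distribʳ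
      }
    ; *-comm = *-comm
    }
  }

1≉0 : 1# ≉ 0#
1≉0 e with Poly.at (cross e) zero
... | ()

num≉0 : ∀ {r} → r ≉ 0# → num r Poly.≉ Poly.0#
num≉0 {r} r≉0 e = r≉0 (mk≈ (Poly.≈-trans (Poly.*-identityʳ (num r)) e))

recip : (r : ℚ⟨T⟩) → r ≉ 0# → ℚ⟨T⟩
recip r r≉0 = frac (den r) (num r) (num≉0 r≉0)

*-recip : ∀ r (r≉0 : r ≉ 0#) → r * recip r r≉0 ≈ 1#
*-recip (frac p q _) r≉0 = mk≈ (Poly.≈-trans (Poly.*-identityʳ (p Poly.* q))
  (Poly.≈-trans (Poly.*-comm p q) (Poly.≈-sym (Poly.*-identityˡ (q Poly.* p)))))

IsConstant : ℚ⟨T⟩ → Set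
IsConstant r = ∃ λ a → r ≈ fromℚ a

f : (b c : ℤ) (x : ℚ⟨T⟩) → x ≉ 0# → ℚ⟨T⟩
f b c x x≉0 = x + fromℤ b + fromℤ c * recip x x≉0

record ParametricTriple : Set where
  field
    x y z          : ℚ⟨T⟩
    x≉0            : x ≉ 0#
    y≉0            : y ≉ 0#
    notAllConstant : ¬ (IsConstant x × IsConstant y × IsConstant z)

-- Triples are the same when their entries agree as rational functions;
-- the proof components do not matter.
tripleSetoid : Setoid 0ℓ 0ℓ
tripleSetoid = On.setoid (×-setoid setoid (×-setoid setoid setoid)) entries
  where
  entries : ParametricTriple → ℚ⟨T⟩ × ℚ⟨T⟩ × ℚ⟨T⟩
  entries t = x , y , z
    where open ParametricTriple t

module _ (b c : ℤ) (t : ParametricTriple) where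
  open ParametricTriple t

  private
    fx fy : ℚ⟨T⟩
    fx = f b c x x≉0
    fy = f b c y y≉0

  SolvesSum SolvesDifference NontrivialSum NontrivialDifference : Set
  SolvesSum            = z ² ≈ fx ² + fy ²
  SolvesDifference     = z ² ≈ fx ² - fy ²
  NontrivialSum        = fx * fy ≉ 0#
  NontrivialDifference = fx ² ≉ fy ²

InfinitelyMany : (ParametricTriple → Set) → Set
InfinitelyMany P =
  Injection (≡.setoid ℕ) (On.setoid tripleSetoid (proj₁ {A = ParametricTriple} {B = P}))

{-# OPTIONS --safe #-}

-- Put g = b(1 + u²), h = b(1 − u²), w = gh, e = 4c and look for solutions of the
-- difference equation on the line x = Qg, y = Qh.  With V = 1/(4Qw) one finds
--   f(x)² − f(y)² = 4b²u² (Q − eV)(Q + 1 + eV),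
-- and this equals (bu(2Q + 1 − wV))² exactly when (4e² + w²)V = 2w − 4e, which
-- determines V and hence Q.  (This is the second point, besides the obvious one at
-- infinity, of a genus 1 quartic with square leading coefficient over ℚ(u).)
-- With u = 1 + (n + 1)T every nonvanishing condition, except that of w, follows from
-- the values at T = 0, where u = 1 and w = 0; distinct n give distinct u², and u² is recovered
-- from x + y = 2bQ and y = Qb(1 − u²).
module Submission where

open import Algebra.Bundles using (CommutativeRing)
import Algebra.Properties.Group
import Algebra.Solver.Ring.NaturalCoefficients.Default
open import Data.Integer.Base using (ℤ; 0ℤ; +_)
import Data.Integer.Properties as ℤ
open import Data.List.Base using ([]; _∷_)
open import Data.Nat.Base using (ℕ; suc)
import Data.Nat.Properties as ℕ
open import Data.Product.Base using (_×_; _,_; proj₂)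
open import Data.Rational.Base as ℚ using (ℚ; 0ℚ; 1ℚ; ½)
import Data.Rational.Properties as ℚ
open import Data.Rational.Unnormalised.Base using (mkℚᵘ; *≡*)
open import Data.Sum.Base using (_⊎_; inj₂)
open import Level as Level using (_⊔_)
open import Relation.Binary.Bundles using (Setoid)
open import Relation.Binary.PropositionalEquality as ≡ using (_≡_; _≢_)
import Relation.Binary.Reasoning.Setoid
open import Relation.Nullary.Negation using (¬_)

-- Identities in a commutative ring.

module RingIdentities {a ℓ} (R : CommutativeRing a ℓ) where
  open CommutativeRing R
  open Algebra.Properties.Group +-group using (∙-cancelʳ)
  open Algebra.Solver.Ring.NaturalCoefficients.Default commutativeSemiring
    using (Polynomial; solve; _:+_; _:*_; _:=_; con)
  open Relation.Binary.Reasoning.Setoid setoid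

  double quadruple : Carrier → Carrier
  double x    = x + x
  quadruple x = double (double x)

  private
    :2 :4 : ∀ {n} → Polynomial n → Polynomial n
    :2 p = p :+ p
    :4 p = :2 (:2 p)

  sub+ : ∀ x y → (x - y) + y ≈ x
  sub+ x y = trans (+-assoc x (- y) y)
    (trans (+-congˡ (-‿inverseˡ y)) (+-identityʳ x))

  +⇒sub : ∀ {x y d} → d + y ≈ x → d ≈ x - y
  +⇒sub {x} {y} e = ∙-cancelʳ y _ _ (trans e (sym (sub+ x y)))

  -- With `y = V * w` and `s = e * V`, squaring `ζ + y ≈ 2Q + 1` and using `4Qy ≈ 1` turns the claim
  -- into `4s² + y² + 4s ≈ 2y`. Every term has a factor `V`; what remains after removing it is the
  -- linear equation `V * M ≈ L`.
  root-squared : ∀ {e w V L M Q ζ} →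
    M ≈ w * w + quadruple (e * e) →
    V * M ≈ L →
    L + quadruple e ≈ double w →
    Q * (quadruple V * w) ≈ 1# →
    ζ + V * w ≈ double Q + 1# →
    ζ * ζ + quadruple (e * V + (e * V) * (e * V)) ≈ quadruple (Q + Q * Q)
  root-squared {e} {w} {V} {L} {M} {Q} {ζ} M-def VM≈L L-def Q-inv ζ-def =
    -- Adding `1 + y²` completes the square `(2Q + 1)²` on the right and keeps every identity free
    -- of subtraction.
    ∙-cancelʳ (1# + y * y) _ _ (begin
      ζ * ζ + quadruple (s + s * s) + (1# + y * y)
        ≈⟨ solve 3 (λ Z S Y → Z :* Z :+ :4 (S :+ S :* S) :+ (con 1 :+ Y :* Y)
             := Z :* Z :+ con 1 :+ (:4 (S :* S) :+ Y :* Y :+ :4 S)) refl ζ s y ⟩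
      ζ * ζ + 1# + (quadruple (s * s) + y * y + quadruple s)
        ≈⟨ +-congˡ double-y ⟨
      ζ * ζ + 1# + double y
        ≈⟨ +-congʳ (+-congˡ Q-inv) ⟨
      ζ * ζ + Q * (quadruple V * w) + double y
        ≈⟨ solve 4 (λ Z q W v → Z :* Z :+ q :* (:4 v :* W) :+ :2 (v :* W)
               := Z :* Z :+ :2 (v :* W) :* (:2 q :+ con 1)) refl ζ Q w V ⟩
      ζ * ζ + double y * (double Q + 1#)
        ≈⟨ +-congˡ (*-congˡ ζ-def) ⟨
      ζ * ζ + double y * (ζ + y)
        ≈⟨ solve 2 (λ Z Y → Z :* Z :+ :2 Y :* (Z :+ Y)
             := (Z :+ Y) :* (Z :+ Y) :+ Y :* Y) refl ζ y ⟩
      (ζ + y) * (ζ + y) + y * y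
        ≈⟨ +-congʳ (*-cong ζ-def ζ-def) ⟩
      (double Q + 1#) * (double Q + 1#) + y * y
        ≈⟨ solve 2 (λ q Y → (:2 q :+ con 1) :* (:2 q :+ con 1) :+ Y :* Y
             := :4 (q :+ q :* q) :+ (con 1 :+ Y :* Y)) refl Q y ⟩
      quadruple (Q + Q * Q) + (1# + y * y) ∎)
    where
    s y : Carrier
    s = e * V
    y = V * w
    double-y : double y ≈ quadruple (s * s) + y * y + quadruple s
    double-y = begin
      double (V * w)
        ≈⟨ distribˡ V w w ⟨
      V * double w
        ≈⟨ *-congˡ L-def ⟨
      V * (L + quadruple e)
        ≈⟨ *-congˡ (+-congʳ (trans (*-congˡ (sym M-def)) VM≈L)) ⟨
      V * (V * (w * w + quadruple (e * e)) + quadruple e)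
        ≈⟨ solve 3 (λ E W v → v :* (v :* (W :* W :+ :4 (E :* E)) :+ :4 E)
             := :4 ((E :* v) :* (E :* v)) :+ (v :* W) :* (v :* W) :+ :4 (E :* v))
             refl e w V ⟩
      quadruple (s * s) + y * y + quadruple s ∎

  -- The reciprocals make `c * x⁻¹ ≈ s * h` and `c * y⁻¹ ≈ s * g`, so `fx` and `fy` differ by
  -- exchanging `g` and `h`. Hence `fx - fy` has the factor `g - h ≈ 2j`, and `fx + fy` the factor
  -- `g + h ≈ 2b`; since `j ≈ bu²`, their product is a square as soon as the cofactor is one.
  difference-is-square : ∀ {b c u j h V Q ζ x⁻¹ y⁻¹} →
    let s = quadruple c * V ; g = h + double j ; z = (b * u) * ζ
        fx = Q * g + b + c * x⁻¹ ; fy = Q * h + b + c * y⁻¹ in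
    b ≈ h + j →
    j ≈ b * (u * u) →
    x⁻¹ ≈ quadruple V * h →
    y⁻¹ ≈ quadruple V * g →
    ζ * ζ + quadruple (s + s * s) ≈ quadruple (Q + Q * Q) →
    z * z ≈ fx * fx - fy * fy
  difference-is-square {b} {c} {u} {j} {h} {V} {Q} {ζ} {x⁻¹} {y⁻¹}
    b-def j-def x-inv y-inv ζ² = +⇒sub (∙-cancelʳ k _ _ (begin
      z * z + fy * fy + k
        ≈⟨ +-congʳ (+-cong z² (*-cong fy≈ fy≈)) ⟩
      (h + j) * j * (ζ * ζ) + fy′ * fy′ + k
        ≈⟨ solve 5 (λ H J Z S F → (H :+ J) :* J :* Z :+ F :+ (H :+ J) :* J :* S
             := F :+ (H :+ J) :* J :* (Z :+ S)) refl h j (ζ * ζ) (quadruple (s + s * s)) (fy′ * fy′) ⟩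
      fy′ * fy′ + (h + j) * j * (ζ * ζ + quadruple (s + s * s))
        ≈⟨ +-congˡ (*-congˡ ζ²) ⟩
      fy′ * fy′ + (h + j) * j * quadruple (Q + Q * Q)
        -- This is `(G - F)(G + F)` with `G - F = 2J(q - S)` and `G + F = 2(H + J)(q + 1 + S)`, its
        -- negative terms moved across as `k`.
        ≈⟨ solve 4 (λ q H J S →
             let F = q :* H :+ (H :+ J) :+ S :* (H :+ :2 J)
                 G = q :* (H :+ :2 J) :+ (H :+ J) :+ S :* H in
             F :* F :+ (H :+ J) :* J :* :4 (q :+ q :* q)
             := G :* G :+ (H :+ J) :* J :* :4 (S :+ S :* S)) refl Q h j s ⟩
      fx′ * fx′ + k
        ≈⟨ +-congʳ (*-cong fx≈ fx≈) ⟨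
      fx * fx + k ∎))
    where
    s g z fx fy fx′ fy′ k : Carrier
    s = quadruple c * V
    g = h + double j
    z = (b * u) * ζ
    fx = Q * g + b + c * x⁻¹
    fy = Q * h + b + c * y⁻¹
    fx′ = Q * g + (h + j) + s * h
    fy′ = Q * h + (h + j) + s * g
    k = (h + j) * j * quadruple (s + s * s)
    shift : ∀ c V h → c * (quadruple V * h) ≈ (quadruple c * V) * h
    shift = solve 3 (λ C v H → C :* (:4 v :* H) := (:4 C :* v) :* H) refl
    fx≈ : fx ≈ fx′
    fx≈ = +-cong (+-congˡ b-def) (trans (*-congˡ x-inv) (shift c V h))
    fy≈ : fy ≈ fy′
    fy≈ = +-cong (+-congˡ b-def) (trans (*-congˡ y-inv) (shift c V g))
    z² : z * z ≈ (h + j) * j * (ζ * ζ)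
    z² = begin
      z * z                        ≈⟨ solve 3 (λ B U Z → ((B :* U) :* Z) :* ((B :* U) :* Z)
                                        := B :* (B :* (U :* U)) :* (Z :* Z)) refl b u ζ ⟩
      b * (b * (u * u)) * (ζ * ζ)  ≈⟨ *-congʳ (*-cong b-def (sym j-def)) ⟩
      (h + j) * j * (ζ * ζ)        ∎

  regroupˡ : ∀ q g t h → (q * g) * (t * h) ≈ q * (t * (g * h))
  regroupˡ = solve 4 (λ q g t h → (q :* g) :* (t :* h) := q :* (t :* (g :* h))) refl

  regroupʳ : ∀ q g t h → (q * h) * (t * g) ≈ q * (t * (g * h))
  regroupʳ = solve 4 (λ q g t h → (q :* h) :* (t :* g) := q :* (t :* (g :* h))) refl

  sum-of-arguments : ∀ {q b h j} → h + j ≈ b → q * (h + double j) + q * h ≈ double b * q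
  sum-of-arguments {q} {b} {h} {j} e = trans
    (solve 3 (λ q h j → q :* (h :+ :2 j) :+ q :* h := :2 (h :+ j) :* q) refl q h j)
    (*-congʳ (+-cong e e))

  -- Used to show that `ζ` is nonzero: there `q` has a pole at T = 0, so the equation `y ≈ 2q + 1`
  -- has to be multiplied by `p` before it can be specialised.
  cleared-root : ∀ {q p y ζ} →
    q * p ≈ 1# → ζ ≈ 0# → ζ + y ≈ double q + 1# → p + double 1# ≈ y * p
  cleared-root {q} {p} {y} {ζ} qp≈1 ζ≈0 ζ-def = begin
    p + double 1#         ≈⟨ +-congˡ (+-cong qp≈1 qp≈1) ⟨
    p + double (q * p)    ≈⟨ solve 2 (λ q p → p :+ :2 (q :* p) := (:2 q :+ con 1) :* p) refl q p ⟩
    (double q + 1#) * p   ≈⟨ *-congʳ ζ-def ⟨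
    (ζ + y) * p           ≈⟨ *-congʳ (trans (+-congʳ ζ≈0) (+-identityˡ y)) ⟩
    y * p                 ∎

-- Fields with a local subring.

-- The construction is carried out over an abstract field with a local subring, because
-- the operations of ℚ⟨T⟩ unfold eagerly to ever larger polynomials.
record LocalisedField {a ℓ} (R : CommutativeRing a ℓ) : Set (Level.suc (a ⊔ ℓ)) where
  open CommutativeRing R
  field
    1≉0     : 1# ≉ 0#
    *-≉0    : ∀ {x y} → x ≉ 0# → y ≉ 0# → x * y ≉ 0#
    recip   : ∀ x → x ≉ 0# → Carrier
    *-recip : ∀ x (x≉0 : x ≉ 0#) → x * recip x x≉0 ≈ 1#
    Regular Unit Small : Carrier → Set ℓ
    -- The only field linking the three predicates to `≈`; they concern representatives and need not
    -- respect it.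
    unit-not-small : ∀ {x y} → x ≈ y → Unit x → ¬ Small y
    unit⇒regular   : ∀ {x} → Unit x → Regular x
    small⇒regular  : ∀ {x} → Small x → Regular x
    1-unit      : Unit 1#
    0-small     : Small 0#
    unit-neg    : ∀ {x} → Unit x → Unit (- x)
    unit-recip  : ∀ {x} (x≉0 : x ≉ 0#) → Unit x → Unit (recip x x≉0)
    unit-double : ∀ {x} → Unit x → Unit (x + x)
    unit-*      : ∀ {x y} → Unit x → Unit y → Unit (x * y)
    small-*     : ∀ {x y} → Regular x → Small y → Small (x * y)
    small-+     : ∀ {x y} → Small x → Small y → Small (x + y)
    small+unit  : ∀ {x y} → Small x → Unit y → Unit (x + y)

  unit⇒≉0 : ∀ {x} → Unit x → x ≉ 0#
  unit⇒≉0 x-unit x≈0 = unit-not-small x≈0 x-unit 0-small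

  inverse≉0 : ∀ {x y} → x * y ≈ 1# → x ≉ 0#
  inverse≉0 {y = y} xy≈1 x≈0 = 1≉0 (trans (sym xy≈1) (trans (*-congʳ x≈0) (zeroˡ y)))

  recip-* : ∀ x (x≉0 : x ≉ 0#) → recip x x≉0 * x ≈ 1#
  recip-* x x≉0 = trans (*-comm _ x) (*-recip x x≉0)

  *-cancelˡ : ∀ {x y z} → x ≉ 0# → x * y ≈ x * z → y ≈ z
  *-cancelˡ {x} {y} {z} x≉0 e = trans (sym (undo y)) (trans (*-congˡ e) (undo z))
    where
    undo : ∀ y → recip x x≉0 * (x * y) ≈ y
    undo y = trans (sym (*-assoc _ x y)) (trans (*-congʳ (recip-* x x≉0)) (*-identityˡ y))

  recip-unique : ∀ {x y} (x≉0 : x ≉ 0#) → x * y ≈ 1# → recip x x≉0 ≈ y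
  recip-unique x≉0 xy≈1 = *-cancelˡ x≉0 (trans (*-recip _ x≉0) (sym xy≈1))

-- The solution attached to a parameter `u`.

module Construction {a ℓ} {R : CommutativeRing a ℓ} (K : LocalisedField R)
  (b c : CommutativeRing.Carrier R)
  (b-unit : LocalisedField.Unit K b) (c-unit : LocalisedField.Unit K c) where

  open CommutativeRing R
  open RingIdentities R
  open LocalisedField K

  record Solution (u : Carrier) : Set (a ⊔ ℓ) where
    field
      x y z Q : Carrier
      x≉0     : x ≉ 0#
      y≉0     : y ≉ 0#
      Q≉0     : Q ≉ 0#

    fx : Carrier
    fx = x + b + c * recip x x≉0
    fy : Carrier
    fy = y + b + c * recip y y≉0

    field
      -- A pole at T = 0, phrased through all representatives because `Regular` need not respect
      -- `≈`. It excludes constants.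
      x-not-regular : ∀ {r} → Regular r → ¬ (x ≈ r)
      solves        : z * z ≈ fx * fx - fy * fy
      nontrivial    : ¬ (fx * fx ≈ fy * fy)
      x+y≈2bQ       : x + y ≈ double b * Q
      y≈Qh          : y ≈ Q * (b * (1# - u * u))

  -- The sum `x + y` fixes `Q`, and then `y` fixes `1 - u²`. In `Construct`, `u` and `- u` lead to
  -- the same `x` and `y`, so only the square is recoverable.
  u²-determined : ∀ {u u′} (s : Solution u) (s′ : Solution u′) → let open Solution in
    x s ≈ x s′ → y s ≈ y s′ → u * u ≈ u′ * u′
  u²-determined s s′ x≈ y≈ =
    ⁻¹-injective (∙-cancelˡ 1# _ _ (*-cancelˡ (unit⇒≉0 b-unit) (*-cancelˡ S.Q≉0
      (trans (sym S.y≈Qh) (trans y≈ (trans S′.y≈Qh (*-congʳ (sym Q≈))))))))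
    where
    module S  = Solution s
    module S′ = Solution s′
    open Algebra.Properties.Group +-group using (∙-cancelˡ; ⁻¹-injective)
    Q≈ : S.Q ≈ S′.Q
    Q≈ = *-cancelˡ (unit⇒≉0 (unit-double b-unit))
      (trans (sym S.x+y≈2bQ) (trans (+-cong x≈ y≈) S′.x+y≈2bQ))

  -- Since `1 - u²` vanishes at T = 0, so do `h` and `w`, while `g`, `M`, `L` take the nonzero
  -- values `2b`, `4e²`, `-4e`. That `w` is nonzero as a field element rests on `1-u²≉0`.
  module Construct (u : Carrier) (u-unit : Unit u)
    (1-u²≉0 : 1# - u * u ≉ 0#) (1-u²-small : Small (1# - u * u)) where

    h j g w e L M : Carrier
    h = b * (1# - u * u)
    j = b * (u * u)
    g = h + double j
    w = g * h
    e = quadruple c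
    M = w * w + quadruple (e * e)
    L = double w - quadruple e

    h+j≈b : h + j ≈ b
    h+j≈b = trans (sym (distribˡ b _ _)) (trans (*-congˡ (sub+ 1# (u * u))) (*-identityʳ b))

    unit-quadruple : ∀ {x} → Unit x → Unit (quadruple x)
    unit-quadruple x-unit = unit-double (unit-double x-unit)

    e-unit : Unit e
    e-unit = unit-quadruple c-unit

    h-small : Small h
    h-small = small-* (unit⇒regular b-unit) 1-u²-small

    g-unit : Unit g
    g-unit = small+unit h-small (unit-double (unit-* b-unit (unit-* u-unit u-unit)))

    w-small : Small w
    w-small = small-* (unit⇒regular g-unit) h-small

    M-unit : Unit M
    M-unit = small+unit (small-* (small⇒regular w-small) w-small)
      (unit-quadruple (unit-* e-unit e-unit))

    L-unit : Unit L
    L-unit = small+unit (small-+ w-small w-small) (unit-neg (unit-quadruple e-unit))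

    M≉0 : M ≉ 0#
    M≉0 = unit⇒≉0 M-unit

    V P : Carrier
    V = L * recip M M≉0
    P = quadruple V * w

    VM≈L : V * M ≈ L
    VM≈L = trans (*-assoc L _ M) (trans (*-congˡ (recip-* M M≉0)) (*-identityʳ L))

    V-unit : Unit V
    V-unit = unit-* L-unit (unit-recip M≉0 M-unit)

    h≉0 : h ≉ 0#
    h≉0 = *-≉0 (unit⇒≉0 b-unit) 1-u²≉0

    P≉0 : P ≉ 0#
    P≉0 = *-≉0 (unit⇒≉0 (unit-quadruple V-unit)) (*-≉0 (unit⇒≉0 g-unit) h≉0)

    P-small : Small P
    P-small = small-* (unit⇒regular (unit-quadruple V-unit)) w-small

    Q x y ζ z : Carrier
    Q = recip P P≉0
    x = Q * g
    y = Q * h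
    ζ = (double Q + 1#) - V * w
    z = (b * u) * ζ

    QP≈1 : Q * P ≈ 1#
    QP≈1 = recip-* P P≉0

    x-inverse : x * (quadruple V * h) ≈ 1#
    x-inverse = trans (regroupˡ Q g (quadruple V) h) QP≈1

    y-inverse : y * (quadruple V * g) ≈ 1#
    y-inverse = trans (regroupʳ Q g (quadruple V) h) QP≈1

    x≉0 : x ≉ 0#
    x≉0 = inverse≉0 x-inverse

    y≉0 : y ≉ 0#
    y≉0 = inverse≉0 y-inverse

    -- If `ζ` vanished, the two sides of `P + 2 ≈ (V * w) * P` would be 2 and 0 at T = 0.
    -- Nontriviality follows, because `z` is a nonzero multiple of `ζ`.
    ζ≉0 : ζ ≉ 0#
    ζ≉0 ζ≈0 = unit-not-small
      (cleared-root QP≈1 ζ≈0 (sub+ (double Q + 1#) (V * w)))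
      (small+unit P-small (unit-double 1-unit))
      (small-* (small⇒regular (small-* (unit⇒regular V-unit) w-small)) P-small)

    z≉0 : z ≉ 0#
    z≉0 = *-≉0 (*-≉0 (unit⇒≉0 b-unit) (unit⇒≉0 u-unit)) ζ≉0

    -- The inverse `4Vh` of `x` vanishes at T = 0, so a regular `r` would force 1 to vanish there.
    x-not-regular : ∀ {r} → Regular r → ¬ (x ≈ r)
    x-not-regular r-regular x≈r = unit-not-small
      (trans (sym x-inverse) (*-congʳ x≈r)) 1-unit
      (small-* r-regular (small-* (unit⇒regular (unit-quadruple V-unit)) h-small))

    solution : Solution u
    solution = record
      { x = x ; y = y ; z = z ; Q = Q
      ; x≉0 = x≉0 ; y≉0 = y≉0 ; Q≉0 = inverse≉0 QP≈1
      ; x-not-regular = x-not-regular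
      ; solves        = solves
      ; nontrivial    = λ fx²≈fy² →
          *-≉0 z≉0 z≉0 (trans solves (trans (+-congʳ fx²≈fy²) (-‿inverseʳ _)))
      ; x+y≈2bQ       = sum-of-arguments h+j≈b
      ; y≈Qh          = refl
      }
      where
      solves : z * z ≈ (x + b + c * recip x x≉0) * (x + b + c * recip x x≉0)
                     - (y + b + c * recip y y≉0) * (y + b + c * recip y y≉0)
      solves = difference-is-square (sym h+j≈b) refl
        (recip-unique x≉0 x-inverse) (recip-unique y≉0 y-inverse)
        (root-squared refl VM≈L (sub+ (double w) (quadruple e)) QP≈1
          (sub+ (double Q + 1#) (V * w)))

-- The field of rational functions, localised at T = 0.

open import Defs

ℚ-double-injective : ∀ {p q} → p ℚ.+ p ≡ q ℚ.+ q → p ≡ q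
ℚ-double-injective {p} {q} e = ≡.trans (≡.sym (halve p))
  (≡.trans (≡.cong (½ ℚ.*_) e) (halve q))
  where
  halve : ∀ p → ½ ℚ.* (p ℚ.+ p) ≡ p
  halve p = ≡.trans (ℚ.*-distribˡ-+ ½ p p)
    (≡.trans (≡.sym (ℚ.*-distribʳ-+ p ½ ½)) (ℚ.*-identityˡ p))

-- Specialisation at T = 0.  Regular, Unit and Small are read off the given fraction,
-- which need not be in lowest terms: T/T is not Regular.

at0 : Poly.ℚ[T] → ℚ
at0 p = Poly.coeff p 0

at0-+ : ∀ p q → at0 (p Poly.+ q) ≡ at0 p ℚ.+ at0 q
at0-+ p q = Poly.coeff-+ p q 0

at0-* : ∀ p q → at0 (p Poly.* q) ≡ at0 p ℚ.* at0 q
at0-* []      q       = ≡.sym (ℚ.*-zeroˡ (at0 q))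
at0-* (a ∷ p) []      = ≡.sym (ℚ.*-zeroʳ a)
at0-* (a ∷ p) (b ∷ q) = ℚ.+-identityʳ (a ℚ.* b)

at0-*-≢0 : ∀ p q → at0 p ≢ 0ℚ → at0 q ≢ 0ℚ → at0 (p Poly.* q) ≢ 0ℚ
at0-*-≢0 p q p≢0 q≢0 e = q≢0 (Poly.ℚ-cancelˡ p≢0 (≡.trans (≡.sym (at0-* p q)) e))

at0-*-≡0ˡ : ∀ p q → at0 p ≡ 0ℚ → at0 (p Poly.* q) ≡ 0ℚ
at0-*-≡0ˡ p q e =
  ≡.trans (at0-* p q) (≡.trans (≡.cong (ℚ._* at0 q) e) (ℚ.*-zeroˡ (at0 q)))

at0-+-≡0ˡ : ∀ p q → at0 p ≡ 0ℚ → at0 (p Poly.+ q) ≡ at0 q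
at0-+-≡0ˡ p q e =
  ≡.trans (at0-+ p q) (≡.trans (≡.cong (ℚ._+ at0 q) e) (ℚ.+-identityˡ (at0 q)))

Regular Unit Small : ℚ⟨T⟩ → Set
Regular r = at0 (den r) ≢ 0ℚ
Unit r    = at0 (num r) ≢ 0ℚ × Regular r
Small r   = at0 (num r) ≡ 0ℚ × Regular r

-- In the cross-multiplied equation the left side is nonzero at T = 0 and the right side is zero; no
-- reduction to lowest terms is involved.
unit-not-small : ∀ {r s} → r ≈ s → Unit r → ¬ Small s
unit-not-small {r} {s} e (n≢0 , _) (m≡0 , d≢0) =
  at0-*-≢0 (num r) (den s) n≢0 d≢0
    (≡.trans (Poly.at (cross e) 0) (at0-*-≡0ˡ (num s) (den r) m≡0))

unit-neg : ∀ {r} → Unit r → Unit (- r)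
unit-neg {frac p q _} (p≢0 , q≢0) =
  (λ e → p≢0 (ℚ.neg-injective (≡.trans (≡.sym (Poly.coeff-neg p 0)) e))) , q≢0

unit-double : ∀ {r} → Unit r → Unit (r + r)
unit-double {frac p q _} (p≢0 , q≢0) =
  (λ e → at0-*-≢0 p q p≢0 q≢0
     (ℚ-double-injective (≡.trans (≡.sym (at0-+ (p Poly.* q) (p Poly.* q))) e))) ,
  at0-*-≢0 q q q≢0 q≢0

unit-* : ∀ {r s} → Unit r → Unit s → Unit (r * s)
unit-* {frac p q _} {frac u v _} (p≢0 , q≢0) (u≢0 , v≢0) =
  at0-*-≢0 p u p≢0 u≢0 , at0-*-≢0 q v q≢0 v≢0

small-* : ∀ {r s} → Regular r → Small s → Small (r * s)
small-* {frac p q _} {frac u v _} q≢0 (u≡0 , v≢0) =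
  ≡.trans (Poly.at (Poly.*-comm p u) 0) (at0-*-≡0ˡ u p u≡0) , at0-*-≢0 q v q≢0 v≢0

small-+ : ∀ {r s} → Small r → Small s → Small (r + s)
small-+ {frac p q _} {frac u v _} (p≡0 , q≢0) (u≡0 , v≢0) =
  ≡.trans (at0-+-≡0ˡ (p Poly.* v) (u Poly.* q) (at0-*-≡0ˡ p v p≡0)) (at0-*-≡0ˡ u q u≡0) ,
  at0-*-≢0 q v q≢0 v≢0

small+unit : ∀ {r s} → Small r → Unit s → Unit (r + s)
small+unit {frac p q _} {frac u v _} (p≡0 , q≢0) (u≢0 , v≢0) =
  (λ e → at0-*-≢0 u q u≢0 q≢0 (≡.trans
     (≡.sym (at0-+-≡0ˡ (p Poly.* v) (u Poly.* q) (at0-*-≡0ˡ p v p≡0))) e)) ,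
  at0-*-≢0 q v q≢0 v≢0

*-≉0 : ∀ {r s} → r ≉ 0# → s ≉ 0# → r * s ≉ 0#
*-≉0 {r} {s} r≉0 s≉0 e = Poly.*-≉0 (num≉0 {r} r≉0) (num≉0 {s} s≉0)
  (Poly.≈-trans (Poly.≈-sym (Poly.*-identityʳ (num r Poly.* num s))) (cross e))

localisedField : LocalisedField commutativeRing
localisedField = record
  { 1≉0            = 1≉0
  ; *-≉0           = λ {r} {s} → *-≉0 {r} {s}
  ; recip          = recip
  ; *-recip        = *-recip
  ; Regular        = Regular
  ; Unit           = Unit
  ; Small          = Small
  ; unit-not-small = unit-not-small
  ; unit⇒regular   = proj₂
  ; small⇒regular  = proj₂
  ; 1-unit         = (λ ()) , (λ ())
  ; 0-small        = ≡.refl , (λ ())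
  ; unit-neg       = λ {r} → unit-neg {r}
  ; unit-recip     = λ _ (p≢0 , q≢0) → q≢0 , p≢0
  ; unit-double    = λ {r} → unit-double {r}
  ; unit-*         = λ {r} {s} → unit-* {r} {s}
  ; small-*        = λ {r} {s} → small-* {r} {s}
  ; small-+        = λ {r} {s} → small-+ {r} {s}
  ; small+unit     = λ {r} {s} → small+unit {r} {s}
  }

-- The parameters `u = 1 + qT`.

line : ℚ → ℚ⟨T⟩
line q = fromPoly (1ℚ ∷ q ∷ [])

-- The coefficient of T in `(1 + qT)²` is `2q`.
line²-injective : ∀ q r → line q * line q ≈ line r * line r → q ≡ r
line²-injective q r e = ℚ-double-injective
  (≡.trans (≡.sym (linear q)) (≡.trans (Poly.at squares 1) (linear r)))
  where
  square : ℚ → Poly.ℚ[T]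
  square q = num (line q * line q)
  squares : square q Poly.≈ square r
  squares = Poly.≈-trans (Poly.≈-sym (Poly.*-identityʳ (square q)))
    (Poly.≈-trans (cross e) (Poly.*-identityʳ (square r)))
  linear : ∀ q → Poly.coeff (square q) 1 ≡ q ℚ.+ q
  linear q = ≡.cong₂ ℚ._+_ (ℚ.*-identityˡ q) (≡.trans (ℚ.+-identityʳ (q ℚ.* 1ℚ)) (ℚ.*-identityʳ q))

line-0² : line 0ℚ * line 0ℚ ≈ 1#
line-0² = mk≈ (Poly.∷-cong ≡.refl (Poly.0∷-zero ≡.refl (Poly.0∷-zero ≡.refl Poly.≈-refl)))

line-unit : ∀ q → Unit (line q)
line-unit q = (λ ()) , (λ ())

1-line²-small : ∀ q → Small (1# - line q * line q)
1-line²-small q = ≡.refl , (λ ())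

1-line²≉0 : ∀ q → q ≢ 0ℚ → 1# - line q * line q ≉ 0#
1-line²≉0 q q≢0 1-u²≈0 = q≢0 (≡.sym (line²-injective 0ℚ q
  (≈-trans line-0² (∙-cancelʳ (- (line q * line q)) 1# (line q * line q)
    (≈-trans 1-u²≈0 (≈-sym (-‿inverseʳ (line q * line q))))))))
  where open Algebra.Properties.Group (CommutativeRing.+-group commutativeRing) using (∙-cancelʳ)

/1-injective : ∀ {i j} → i ℚ./ 1 ≡ j ℚ./ 1 → i ≡ j
/1-injective {i} {j} e with ℚ./-injective-≃ (mkℚᵘ i 0) (mkℚᵘ j 0) e
... | *≡* i*1≡j*1 = ≡.trans (≡.sym (ℤ.*-identityʳ i)) (≡.trans i*1≡j*1 (ℤ.*-identityʳ j))

fromℤ-unit : ∀ {n} → n ≢ 0ℤ → Unit (fromℤ n)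
fromℤ-unit n≢0 = (λ e → n≢0 (/1-injective e)) , (λ ())

-- The infinite family.

module Family (b c : ℤ) (b≢0 : b ≢ 0ℤ) (c≢0 : c ≢ 0ℤ) where

  open Construction localisedField (fromℤ b) (fromℤ c) (fromℤ-unit b≢0) (fromℤ-unit c≢0)

  slope : ℕ → ℚ
  -- The shift by one avoids slope 0, where `1 - u²` would be identically zero.
  slope n = + suc n ℚ./ 1

  slope≢0 : ∀ n → slope n ≢ 0ℚ
  slope≢0 n e with /1-injective {+ suc n} {0ℤ} e
  ... | ()

  solution : ∀ n → Solution (line (slope n))
  solution n = Construct.solution (line (slope n)) (line-unit (slope n))
    (1-line²≉0 (slope n) (slope≢0 n)) (1-line²-small (slope n))

  module _ {u : ℚ⟨T⟩} (s : Solution u) where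
    open Solution s

    triple : ParametricTriple
    triple = record
      { x = x ; y = y ; z = z ; x≉0 = x≉0 ; y≉0 = y≉0
      -- Already `x` is nonconstant: a constant has denominator 1 and is therefore regular.
      ; notAllConstant = λ ((a , x≈a) , _) → x-not-regular {fromℚ a} (λ ()) x≈a
      }

    triple-solves : SolvesDifference b c triple
    triple-solves = solves

    triple-nontrivial : NontrivialDifference b c triple
    triple-nontrivial = nontrivial

  slope-determined : ∀ {m n} (s : Solution (line (slope m))) (s′ : Solution (line (slope n))) →
    Solution.x s ≈ Solution.x s′ → Solution.y s ≈ Solution.y s′ → m ≡ n
  slope-determined {m} {n} s s′ x≈ y≈ = ℕ.suc-injective (ℤ.+-injective (/1-injective
    (line²-injective (slope m) (slope n) (u²-determined s s′ x≈ y≈))))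

  -- Stated for an arbitrary family so that the solutions are never unfolded.
  infinitelyMany : (∀ n → Solution (line (slope n))) →
    InfinitelyMany (λ t → SolvesDifference b c t × NontrivialDifference b c t)
  infinitelyMany s = record
    { to        = λ n → triple (s n) , triple-solves (s n) , triple-nontrivial (s n)
    ; cong      = λ { {m} ≡.refl → Setoid.refl tripleSetoid {triple (s m)} }
    ; injective = λ {m} {n} (x≈ , y≈ , _) → slope-determined (s m) (s n) x≈ y≈
    }

theorem1p1 : (b c : ℤ) → b ≢ 0ℤ → c ≢ 0ℤ →
    InfinitelyMany (λ t → SolvesSum b c t × NontrivialSum b c t) ⊎
    InfinitelyMany (λ t → SolvesDifference b c t × NontrivialDifference b c t)
theorem1p1 b c b≢0 c≢0 = inj₂ (infinitelyMany solution)
  where open Family b c b≢0 c≢0
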